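{- The diminishing weight distance $wd$ is a distance metric on $\mathcal{C}$; that is, for all $G,H,J\in\mathcal{C}$: (1) $wd(G,G)=0$; (2) if $G\neq H$ then $wd(G,H)>0$; (3) $wd(G,H)=wd(H,G)$; (4) $wd(G,H)\le wd(G,J)+wd(J,H)$.
   Context: $\mathcal{C}$ denotes the set of all short combinatorial games (normal play, finitely many followers, no repeated positions) in canonical form (no dominated or reversible options). For $G\in\mathcal{C}$, $D(G)$ is the bicolored (blue = Left moves, red = Right moves) directed acyclic graph representing $G$: the game tree with nodes representing the same game identified, having a single source (the game $G$) and a single sink (the game $0$). An edit sequence from $G$ to $H$ is a sequence of colored edge removals and/or additions turning $D(G)$ into a colored DAG isomorphic to $D(H)$, without changing which vertex is the source; any vertex that becomes isolated is removed. The cost of an edit is $(1/2)^d$, where $d$ is the distance from the source node of the digraph to the initial node of the edge added or removed. The diminishing weight distance $wd(G,H)$ is the minimum total cost over all edit sequences from $G$ to $H$. -}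

module Defs where

open import Data.Nat using (ℕ; zero; suc)
import Data.Nat as ℕ
open import Data.List using (List; []; _∷_)
open import Data.List.Relation.Unary.All using (All)
open import Data.List.Membership.Propositional using (_∈_; _∉_)
open import Data.List.Relation.Unary.Any using (Any; index)
open import Data.Product using (Σ; ∃; ∃-syntax; _×_; _,_)
open import Data.Sum using (_⊎_)
open import Data.Empty using (⊥)
open import Relation.Nullary using (¬_)
open import Relation.Binary.PropositionalEquality using (_≡_; _≢_)
open import Function.Bundles using (_⇔_)
open import Data.Rational using (ℚ; 0ℚ; 1ℚ; ½; _+_; _*_; _≤_)

data Game : Set where
  ⟨_∣_⟩ : List Game → List Game → Game

leftOpts : Game → List Game
leftOpts ⟨ L ∣ R ⟩ = L

rightOpts : Game → List Game
rightOpts ⟨ L ∣ R ⟩ = R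

mutual
  _≤G_ : Game → Game → Set
  G@(⟨ GL ∣ GR ⟩) ≤G H@(⟨ HL ∣ HR ⟩) = (¬ someRightLe HR G) × (¬ someLeftGe H GL)

  someRightLe : List Game → Game → Set
  someRightLe []       G = ⊥
  someRightLe (X ∷ Xs) G = (X ≤G G) ⊎ someRightLe Xs G

  someLeftGe : Game → List Game → Set
  someLeftGe H []       = ⊥
  someLeftGe H (X ∷ Xs) = (H ≤G X) ⊎ someLeftGe H Xs

_≈G_ : Game → Game → Set
G ≈G H = (G ≤G H) × (H ≤G G)

DistinctEntries : List Game → Game → Game → Set
DistinctEntries Xs X Y = Σ (X ∈ Xs) λ p → Σ (Y ∈ Xs) λ q → index p ≢ index q

HasDominatedLeft : Game → Set
HasDominatedLeft G = ∃[ X ] ∃[ Y ] DistinctEntries (leftOpts G) X Y × (X ≤G Y)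

HasDominatedRight : Game → Set
HasDominatedRight G = ∃[ X ] ∃[ Y ] DistinctEntries (rightOpts G) X Y × (Y ≤G X)

HasReversibleLeft : Game → Set
HasReversibleLeft G = ∃[ X ] (X ∈ leftOpts G) × ∃[ Z ] (Z ∈ rightOpts X) × (Z ≤G G)

HasReversibleRight : Game → Set
HasReversibleRight G = ∃[ X ] (X ∈ rightOpts G) × ∃[ Z ] (Z ∈ leftOpts X) × (G ≤G Z)

data Canonical : Game → Set where
  canon : ∀ {L R} →
          All Canonical L → All Canonical R →
          ¬ HasDominatedLeft ⟨ L ∣ R ⟩ → ¬ HasDominatedRight ⟨ L ∣ R ⟩ →
          ¬ HasReversibleLeft ⟨ L ∣ R ⟩ → ¬ HasReversibleRight ⟨ L ∣ R ⟩ →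
          Canonical ⟨ L ∣ R ⟩

data Colour : Set where
  blue red : Colour

Opt : Colour → Game → Game → Set
Opt blue K K' = K' ∈ leftOpts K
Opt red  K K' = K' ∈ rightOpts K

data Follower (G : Game) : Game → Set where
  self : Follower G G
  step : ∀ {c K K'} → Follower G K → Opt c K K' → Follower G K'

record Edge : Set where
  constructor edge
  field
    colour : Colour
    src    : ℕ
    tgt    : ℕ
open Edge public

-- A coloured digraph with source s is given by a source label s and a finite
-- edge set E (as a list, only membership matters).  Its vertex set consists
-- of s together with all endpoints of edges; thus isolated vertices (other
-- than the source) are automatically removed.
Vertex : ℕ → List Edge → ℕ → Set
Vertex s E u = (u ≡ s) ⊎ (∃[ e ] (e ∈ E) × ((src e ≡ u) ⊎ (tgt e ≡ u)))

RepresentsD : Game → ℕ → List Edge → Set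
RepresentsD G s E =
  Σ (ℕ → Game) λ f →
    (f s ≈G G)
  × (∀ u → Vertex s E u → Follower G (f u))
  × (∀ u v → Vertex s E u → Vertex s E v → f u ≈G f v → u ≡ v)
  × (∀ K → Follower G K → ∃[ u ] Vertex s E u × (f u ≈G K))
  × (∀ c u v → Vertex s E u → Vertex s E v →
       (edge c u v ∈ E) ⇔ (∃[ K ] Opt c (f u) K × (K ≈G f v)))

data Path (E : List Edge) : ℕ → ℕ → ℕ → Set where
  here  : ∀ {u} → Path E u u 0
  there : ∀ {c u w v n} → edge c u w ∈ E → Path E w v n → Path E u v (suc n)

Dist : ℕ → List Edge → ℕ → ℕ → Set
Dist s E u d = Path E s u d × (∀ d' → Path E s u d' → d ℕ.≤ d')

half^ : ℕ → ℚ
half^ zero    = 1ℚ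
half^ (suc d) = ½ * half^ d

data EditStep (s : ℕ) (E : List Edge) : List Edge → ℚ → Set where
  add    : ∀ {E'} e d → e ∉ E →
           (∀ x → (x ∈ E') ⇔ ((x ≡ e) ⊎ (x ∈ E))) →
           Dist s E (src e) d → EditStep s E E' (half^ d)
  remove : ∀ {E'} e d → e ∈ E →
           (∀ x → (x ∈ E') ⇔ ((x ∈ E) × (x ≢ e))) →
           Dist s E (src e) d → EditStep s E E' (half^ d)

data Edits (s : ℕ) : List Edge → List Edge → ℚ → Set where
  done : ∀ {E} → Edits s E E 0ℚ
  _∷_  : ∀ {E E₁ E₂ c c'} → EditStep s E E₁ c → Edits s E₁ E₂ c' →
         Edits s E E₂ (c + c')

EditSeqCost : Game → Game → ℚ → Set
EditSeqCost G H c =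
  ∃[ s ] ∃[ E₀ ] ∃[ E₁ ] RepresentsD G s E₀ × Edits s E₀ E₁ c × RepresentsD H s E₁

IsWD : Game → Game → ℚ → Set
IsWD G H c = EditSeqCost G H c × (∀ c' → EditSeqCost G H c' → c ≤ c')

-- D(G) exists for every G, so the empty edit sequence gives wd(G,G) = 0. Every edit
-- costs a positive power of 1/2, hence a sequence of cost 0 is empty, and then one
-- digraph represents both G and H; two labellings of a digraph by canonical games
-- agree (equal canonical games have matching options), so G = H. An edit can be
-- undone at the same price, since adding or removing an edge out of u does not change
-- the distance to u; this gives symmetry. For the triangle inequality, the last
-- digraph of a sequence G → J and the first of a sequence J → H both represent J,
-- hence differ only by a relabelling of vertices; relabelling the second sequence and
-- appending it to the first gives a sequence G → H of cost a + b.
module Submission where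

open import Defs
open import Data.Product using (_×_)
open import Relation.Nullary using (¬_)
open import Relation.Binary.PropositionalEquality using (_≡_)
open import Data.Rational using (ℚ; 0ℚ; _+_; _≤_; _<_)

open import Level using (Level)
open import Function using (id; _∘_)
open import Function.Bundles using (Equivalence; mk⇔; _⇔_)
open Equivalence using (to; from)
import Function.Properties.Equivalence as ⇔
open import Data.Empty using (⊥-elim)
open import Data.Product using (∃-syntax; _,_; proj₁; proj₂)
import Data.Product as Product
open import Data.Product.Function.NonDependent.Propositional using (_×-⇔_)
open import Data.Sum using (_⊎_; inj₁; inj₂; [_,_]′)
import Data.Sum as Sum
open import Data.Sum.Function.Propositional using (_⊎-⇔_)
open import Relation.Nullary using (Dec; yes; no; ¬?; _×-dec_; _⊎-dec_; decidable-stable)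
open import Relation.Nullary.Decidable using (map′)
open import Relation.Binary.Definitions using (DecidableEquality)
open import Relation.Binary.Structures using (IsDecEquivalence)
open import Relation.Binary.Bundles using (DecSetoid)
import Relation.Binary.Reasoning.Setoid as SetoidReasoning
open import Relation.Binary.PropositionalEquality
  using (_≢_; refl; sym; trans; subst; subst₂; cong; cong₂; module ≡-Reasoning)
import Relation.Binary.PropositionalEquality as ≡
open import Data.Nat using (ℕ; zero; suc; s≤s; z≤n; _≟_; _∸_; _⊔_)
  renaming (_+_ to _+ℕ_; _<_ to _<ℕ_; _≤_ to _≤ℕ_)
open import Data.Nat.Properties
  using (≤-refl; ≤-trans; ≤-antisym; 1+n≰n; m≤m+n; m+n∸m≡n; m≤m⊔n; m≤n⊔m; m≤n⇒m≤n⊔o; m≤n⇒m≤o⊔n)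
open import Data.Rational using (½; Positive; NonNegative)
open import Data.Rational.Properties
  using ( pos*pos⇒pos; pos⇒nonNeg; nonNeg+nonNeg⇒nonNeg; pos+nonNeg⇒pos; positive⁻¹; nonNegative⁻¹
        ; +-identityˡ; +-identityʳ; +-assoc; +-comm)
import Data.Fin as Fin
open import Data.List
  using (List; []; _∷_; _++_; map; foldr; length; filter; deduplicate; upTo; cartesianProduct; cartesianProductWith)
import Data.List.Relation.Unary.All as All
open import Data.List.Relation.Unary.Any using (here; there; index; any?)
import Data.List.Relation.Unary.Any.Properties as Any
open import Data.List.Relation.Unary.AllPairs using (AllPairs; _∷_)
open import Data.List.Relation.Unary.Unique.DecSetoid.Properties using (deduplicate-!)
open import Data.List.Membership.Propositional using (_∈_; _∉_; find; lose)
open import Data.List.Membership.Propositional.Properties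
  using ( ∈-++⁺ˡ; ∈-++⁺ʳ; ∈-++⁻; ∈-map⁺; ∈-map⁻; ∈-upTo⁺; ∈-upTo⁻; ∈-filter⁺; ∈-filter⁻; ∈-deduplicate⁻
        ; ∈-cartesianProductWith⁺; ∈-cartesianProductWith⁻; ∈-cartesianProduct⁺; ∈-cartesianProduct⁻)
open import Data.List.Membership.Setoid.Properties using (index-injective)
open import Data.List.Relation.Binary.Subset.Propositional using (_⊆_)
open import Data.List.Relation.Binary.BagAndSetEquality using (_∼[_]_; set)

private variable
  ℓ : Level
  a b : ℚ
  c : Colour
  d k s u v : ℕ
  E E' F F' : List Edge
  G H J K X Y : Game
  Xs : List Game

-- The order on games

module _ (P : Game → Set ℓ) (step : ∀ X → (∀ c {K} → Opt c X K → P K) → P X) where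
  mutual
    game-ind : ∀ X → P X
    game-ind X = step X (option-ind X)

    option-ind : ∀ X c {K} → Opt c X K → P K
    option-ind ⟨ L ∣ R ⟩ blue = member-ind L
    option-ind ⟨ L ∣ R ⟩ red  = member-ind R

    member-ind : ∀ Xs {K} → K ∈ Xs → P K
    member-ind (X ∷ Xs) (here refl)  = game-ind X
    member-ind (X ∷ Xs) (there K∈Xs) = member-ind Xs K∈Xs

someRightLe⁺ : X ∈ Xs → X ≤G G → someRightLe Xs G
someRightLe⁺ (here refl)  X≤G = inj₁ X≤G
someRightLe⁺ (there X∈Xs) X≤G = inj₂ (someRightLe⁺ X∈Xs X≤G)

someRightLe⁻ : ∀ Xs → someRightLe Xs G → ∃[ X ] X ∈ Xs × X ≤G G
someRightLe⁻ (X ∷ Xs) (inj₁ X≤G) = X , here refl , X≤G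
someRightLe⁻ (X ∷ Xs) (inj₂ r) with Y , Y∈Xs , Y≤G ← someRightLe⁻ Xs r = Y , there Y∈Xs , Y≤G

someLeftGe⁺ : X ∈ Xs → G ≤G X → someLeftGe G Xs
someLeftGe⁺ (here refl)  G≤X = inj₁ G≤X
someLeftGe⁺ (there X∈Xs) G≤X = inj₂ (someLeftGe⁺ X∈Xs G≤X)

someLeftGe⁻ : ∀ Xs → someLeftGe G Xs → ∃[ X ] X ∈ Xs × G ≤G X
someLeftGe⁻ (X ∷ Xs) (inj₁ G≤X) = X , here refl , G≤X
someLeftGe⁻ (X ∷ Xs) (inj₂ l) with Y , Y∈Xs , G≤Y ← someLeftGe⁻ Xs l = Y , there Y∈Xs , G≤Y

≤G-noRight : X ≤G Y → ¬ someRightLe (rightOpts Y) X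
≤G-noRight {⟨ _ ∣ _ ⟩} {⟨ _ ∣ _ ⟩} = proj₁

≤G-noLeft : X ≤G Y → ¬ someLeftGe Y (leftOpts X)
≤G-noLeft {⟨ _ ∣ _ ⟩} {⟨ _ ∣ _ ⟩} = proj₂

mutual
  ≤G-trans : X ≤G Y → Y ≤G J → X ≤G J
  ≤G-trans {⟨ _ ∣ _ ⟩} {⟨ _ ∣ _ ⟩} {⟨ _ ∣ _ ⟩} X≤Y Y≤J =
    (λ r → proj₁ Y≤J (someRightLe-mono X≤Y r)) , (λ l → proj₂ X≤Y (someLeftGe-mono Y≤J l))

  someRightLe-mono : X ≤G Y → someRightLe Xs X → someRightLe Xs Y
  someRightLe-mono {Xs = _ ∷ _} X≤Y (inj₁ W≤X) = inj₁ (≤G-trans W≤X X≤Y)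
  someRightLe-mono {Xs = _ ∷ _} X≤Y (inj₂ r)   = inj₂ (someRightLe-mono X≤Y r)

  someLeftGe-mono : X ≤G Y → someLeftGe Y Xs → someLeftGe X Xs
  someLeftGe-mono {Xs = _ ∷ _} X≤Y (inj₁ Y≤W) = inj₁ (≤G-trans X≤Y Y≤W)
  someLeftGe-mono {Xs = _ ∷ _} X≤Y (inj₂ l)   = inj₂ (someLeftGe-mono X≤Y l)

≤G-refl : ∀ X → X ≤G X
≤G-refl = game-ind (λ X → X ≤G X) λ where
  ⟨ L ∣ R ⟩ ih →
      (λ r → let W , W∈R , W≤X = someRightLe⁻ R r in
             ≤G-noRight W≤X (someRightLe⁺ W∈R (ih red W∈R)))
    , (λ l → let W , W∈L , X≤W = someLeftGe⁻ L l in
             ≤G-noLeft X≤W (someLeftGe⁺ W∈L (ih blue W∈L)))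

rightOption-⋬ : K ∈ rightOpts X → ¬ K ≤G X
rightOption-⋬ K∈XR K≤X = ≤G-noRight K≤X (someRightLe⁺ K∈XR (≤G-refl _))

leftOption-⋭ : K ∈ leftOpts X → ¬ X ≤G K
leftOption-⋭ K∈XL X≤K = ≤G-noLeft X≤K (someLeftGe⁺ K∈XL (≤G-refl _))

≈G-refl : ∀ X → X ≈G X
≈G-refl X = ≤G-refl X , ≤G-refl X

≈G-sym : X ≈G Y → Y ≈G X
≈G-sym (X≤Y , Y≤X) = Y≤X , X≤Y

≈G-trans : X ≈G Y → Y ≈G J → X ≈G J
≈G-trans (X≤Y , Y≤X) (Y≤J , J≤Y) = ≤G-trans X≤Y Y≤J , ≤G-trans J≤Y Y≤X

mutual
  ≤G-dec : ∀ X Y → Dec (X ≤G Y)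
  ≤G-dec X@(⟨ XL ∣ _ ⟩) Y@(⟨ _ ∣ YR ⟩) = ¬? (someRightLe-dec YR X) ×-dec ¬? (someLeftGe-dec Y XL)

  someRightLe-dec : ∀ Xs G → Dec (someRightLe Xs G)
  someRightLe-dec []       G = no λ ()
  someRightLe-dec (X ∷ Xs) G = ≤G-dec X G ⊎-dec someRightLe-dec Xs G

  someLeftGe-dec : ∀ G Xs → Dec (someLeftGe G Xs)
  someLeftGe-dec G []       = no λ ()
  someLeftGe-dec G (X ∷ Xs) = ≤G-dec G X ⊎-dec someLeftGe-dec G Xs

≈G-dec : ∀ X Y → Dec (X ≈G Y)
≈G-dec X Y = ≤G-dec X Y ×-dec ≤G-dec Y X

≈G-isDecEquivalence : IsDecEquivalence _≈G_
≈G-isDecEquivalence = record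
  { isEquivalence = record { refl = ≈G-refl _ ; sym = ≈G-sym ; trans = ≈G-trans }
  ; _≟_           = ≈G-dec
  }

gameDecSetoid : DecSetoid _ _
gameDecSetoid = record { isDecEquivalence = ≈G-isDecEquivalence }

module ≈G-Reasoning = SetoidReasoning (DecSetoid.setoid gameDecSetoid)

≰G-witness : ¬ X ≤G Y → someRightLe (rightOpts Y) X ⊎ someLeftGe Y (leftOpts X)
≰G-witness {X@(⟨ XL ∣ _ ⟩)} {Y@(⟨ _ ∣ YR ⟩)} X≰Y with someRightLe-dec YR X
... | yes r = inj₁ r
... | no ¬r = inj₂ (decidable-stable (someLeftGe-dec Y XL) λ ¬l → X≰Y (¬r , ¬l))

≤G-by-options : (∀ {K} → K ∈ rightOpts Y → ∃[ K' ] K' ∈ rightOpts X × K' ≤G K)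
              → (∀ {K} → K ∈ leftOpts X → ∃[ K' ] K' ∈ leftOpts Y × K ≤G K')
              → X ≤G Y
≤G-by-options {Y = ⟨ _ ∣ YR ⟩} {X = ⟨ XL ∣ _ ⟩} matchR matchL =
    (λ r → let W , W∈YR , W≤X = someRightLe⁻ YR r
               W' , W'∈XR , W'≤W = matchR W∈YR
           in rightOption-⋬ W'∈XR (≤G-trans W'≤W W≤X))
  , (λ l → let W , W∈XL , Y≤W = someLeftGe⁻ XL l
               W' , W'∈YL , W≤W' = matchL W∈XL
           in leftOption-⋭ W'∈YL (≤G-trans Y≤W W≤W'))

-- Canonical forms

Canonical-option : Canonical X → Opt c X K → Canonical K
Canonical-option {c = blue} (canon canonL _ _ _ _ _) = All.lookup canonL
Canonical-option {c = red}  (canon _ canonR _ _ _ _) = All.lookup canonR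

Canonical-follower : Canonical G → Follower G K → Canonical K
Canonical-follower cG self         = cG
Canonical-follower cG (step G≥K o) = Canonical-option (Canonical-follower cG G≥K) o

leftOption-below : Canonical X → X ≈G Y → K ∈ leftOpts X → ∃[ K' ] K' ∈ leftOpts Y × K ≤G K'
leftOption-below {Y = Y} {K = K} (canon _ _ _ _ ¬revL _) (X≤Y , Y≤X) K∈XL
  with ≰G-witness {Y} {K} (λ Y≤K → leftOption-⋭ K∈XL (≤G-trans X≤Y Y≤K))
... | inj₁ r = let Z , Z∈KR , Z≤Y = someRightLe⁻ (rightOpts K) r
               in ⊥-elim (¬revL (K , K∈XL , Z , Z∈KR , ≤G-trans Z≤Y Y≤X))
... | inj₂ l = someLeftGe⁻ (leftOpts Y) l

rightOption-above : Canonical X → X ≈G Y → K ∈ rightOpts X → ∃[ K' ] K' ∈ rightOpts Y × K' ≤G K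
rightOption-above {Y = Y} {K = K} (canon _ _ _ _ _ ¬revR) (X≤Y , Y≤X) K∈XR
  with ≰G-witness {K} {Y} (λ K≤Y → rightOption-⋬ K∈XR (≤G-trans K≤Y Y≤X))
... | inj₁ r = someRightLe⁻ (rightOpts Y) r
... | inj₂ l = let Z , Z∈KL , Y≤Z = someLeftGe⁻ (leftOpts K) l
               in ⊥-elim (¬revR (K , K∈XR , Z , Z∈KL , ≤G-trans X≤Y Y≤Z))

OptionsMatch : Game → Game → Set
OptionsMatch X Y = ∀ c {K} → Opt c X K → ∃[ K' ] Opt c Y K' × K ≈G K'

-- Matching an option of X into Y and back lands on an option of X comparable with
-- the first; as X has no dominated options, it is the same one.
option-match : Canonical X → Canonical Y → X ≈G Y → OptionsMatch X Y
option-match cX@(canon _ _ ¬domL _ _ _) cY X≈Y blue K∈XL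
  with K' , K'∈YL , K≤K' ← leftOption-below cX X≈Y K∈XL
  with K'' , K''∈XL , K'≤K'' ← leftOption-below cY (≈G-sym X≈Y) K'∈YL
  with index K∈XL Fin.≟ index K''∈XL
... | yes same =
  K' , K'∈YL , K≤K' , subst (K' ≤G_) (sym (index-injective (≡.setoid Game) K∈XL K''∈XL same)) K'≤K''
... | no distinct = ⊥-elim (¬domL (_ , _ , (K∈XL , K''∈XL , distinct) , ≤G-trans K≤K' K'≤K''))
option-match cX@(canon _ _ _ ¬domR _ _) cY X≈Y red K∈XR
  with K' , K'∈YR , K'≤K ← rightOption-above cX X≈Y K∈XR
  with K'' , K''∈XR , K''≤K' ← rightOption-above cY (≈G-sym X≈Y) K'∈YR
  with index K∈XR Fin.≟ index K''∈XR
... | yes same =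
  K' , K'∈YR , subst (_≤G K') (sym (index-injective (≡.setoid Game) K∈XR K''∈XR same)) K''≤K' , K'≤K
... | no distinct = ⊥-elim (¬domR (_ , _ , (K∈XR , K''∈XR , distinct) , ≤G-trans K''≤K' K'≤K))

≈G-by-options : OptionsMatch X Y → OptionsMatch Y X → X ≈G Y
≈G-by-options X⊑Y Y⊑X =
    ≤G-by-options (λ K∈YR → let K' , o , K≈K' = Y⊑X red K∈YR  in K' , o , proj₂ K≈K')
                  (λ K∈XL → let K' , o , K≈K' = X⊑Y blue K∈XL in K' , o , proj₁ K≈K')
  , ≤G-by-options (λ K∈XR → let K' , o , K≈K' = X⊑Y red K∈XR  in K' , o , proj₂ K≈K')
                  (λ K∈YL → let K' , o , K≈K' = Y⊑X blue K∈YL in K' , o , proj₁ K≈K')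

module Representation {G s E} (r : RepresentsD G s E) where

  label : ℕ → Game
  label = proj₁ r

  label-source : label s ≈G G
  label-source = proj₁ (proj₂ r)

  label-follower : Vertex s E u → Follower G (label u)
  label-follower = proj₁ (proj₂ (proj₂ r)) _

  label-injective : Vertex s E u → Vertex s E v → label u ≈G label v → u ≡ v
  label-injective = proj₁ (proj₂ (proj₂ (proj₂ r))) _ _

  label-surjective : Follower G K → ∃[ u ] Vertex s E u × label u ≈G K
  label-surjective = proj₁ (proj₂ (proj₂ (proj₂ (proj₂ r)))) _

  edge⇔option : Vertex s E u → Vertex s E v → (edge c u v ∈ E) ⇔ (∃[ K ] Opt c (label u) K × K ≈G label v)
  edge⇔option = proj₂ (proj₂ (proj₂ (proj₂ (proj₂ r)))) _ _ _

-- Two labellings of one digraph agree at every vertex, by induction on (a game equal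
-- to) the label: matching options are labels of a common successor.
represents-unique : Canonical G → Canonical H → RepresentsD G s E → RepresentsD H s E → G ≈G H
represents-unique {G} {H} {s} {E} cG cH rG rH =
  ≈G-trans (≈G-sym f.label-source)
           (≈G-trans (game-ind Agree agree G cG (inj₁ refl) f.label-source) g.label-source)
  where
  module f = Representation rG
  module g = Representation rH
  open ≈G-Reasoning

  Agree : Game → Set
  Agree X = Canonical X → ∀ {u} → Vertex s E u → f.label u ≈G X → f.label u ≈G g.label u

  agree : ∀ X → (∀ c {X'} → Opt c X X' → Agree X') → Agree X
  agree X ih cX {u} vu fu≈X = ≈G-by-options forth back
    where
    agree-at : ∀ c {K v} → Vertex s E v → Opt c (f.label u) K → f.label v ≈G K → f.label v ≈G g.label v
    agree-at c vv o fv≈K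
      with X' , oX , K≈X' ← option-match (Canonical-follower cG (f.label-follower vu)) cX fu≈X c o
      = ih c oX (Canonical-option cX oX) vv (≈G-trans fv≈K K≈X')

    forth : OptionsMatch (f.label u) (g.label u)
    forth c {K} o
      with v , vv , fv≈K ← f.label-surjective (step (f.label-follower vu) o)
      with K' , o' , K'≈gv ← to (g.edge⇔option vu vv) (from (f.edge⇔option vu vv) (K , o , ≈G-sym fv≈K))
      = K' , o' , (begin
          K           ≈⟨ ≈G-sym fv≈K ⟩
          f.label v   ≈⟨ agree-at c vv o fv≈K ⟩
          g.label v   ≈⟨ ≈G-sym K'≈gv ⟩
          K'          ∎)

    back : OptionsMatch (g.label u) (f.label u)
    back c {K'} o'
      with v , vv , gv≈K' ← g.label-surjective (step (g.label-follower vu) o')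
      with K , o , K≈fv ← to (f.edge⇔option vu vv) (from (g.edge⇔option vu vv) (K' , o' , ≈G-sym gv≈K'))
      = K , o , (begin
          K'          ≈⟨ ≈G-sym gv≈K' ⟩
          g.label v   ≈⟨ ≈G-sym (agree-at c vv o (≈G-sym K≈fv)) ⟩
          f.label v   ≈⟨ ≈G-sym K≈fv ⟩
          K           ∎)

Follower-trans : Follower G X → Follower X K → Follower G K
Follower-trans G≥X self         = G≥X
Follower-trans G≥X (step X≥K o) = step (Follower-trans G≥X X≥K) o

mutual
  followers : Game → List Game
  followers G = G ∷ followersOfOptions G

  followersOfOptions : Game → List Game
  followersOfOptions ⟨ L ∣ R ⟩ = followersOfAll L ++ followersOfAll R

  followersOfAll : List Game → List Game
  followersOfAll []       = []
  followersOfAll (X ∷ Xs) = followers X ++ followersOfAll Xs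

followersOfAll-⊇ : ∀ Xs → X ∈ Xs → X ∈ followersOfAll Xs
followersOfAll-⊇ (Y ∷ _)  (here refl)  = here refl
followersOfAll-⊇ (Y ∷ Ys) (there X∈Ys) = ∈-++⁺ʳ (followers Y) (followersOfAll-⊇ Ys X∈Ys)

mutual
  followers-closed : ∀ G → K ∈ followers G → Opt c K X → X ∈ followers G
  followers-closed {c = blue} ⟨ L ∣ R ⟩ (here refl) o = there (∈-++⁺ˡ (followersOfAll-⊇ L o))
  followers-closed {c = red}  ⟨ L ∣ R ⟩ (here refl) o =
    there (∈-++⁺ʳ (followersOfAll L) (followersOfAll-⊇ R o))
  followers-closed ⟨ L ∣ R ⟩ (there K∈) o with ∈-++⁻ (followersOfAll L) K∈
  ... | inj₁ K∈L = there (∈-++⁺ˡ (followersOfAll-closed L K∈L o))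
  ... | inj₂ K∈R = there (∈-++⁺ʳ (followersOfAll L) (followersOfAll-closed R K∈R o))

  followersOfAll-closed : ∀ Xs → K ∈ followersOfAll Xs → Opt c K X → X ∈ followersOfAll Xs
  followersOfAll-closed (Y ∷ Ys) K∈ o with ∈-++⁻ (followers Y) K∈
  ... | inj₁ K∈Y  = ∈-++⁺ˡ (followers-closed Y K∈Y o)
  ... | inj₂ K∈Ys = ∈-++⁺ʳ (followers Y) (followersOfAll-closed Ys K∈Ys o)

∈-followers⁺ : Follower G K → K ∈ followers G
∈-followers⁺ self         = here refl
∈-followers⁺ (step G≥K o) = followers-closed _ (∈-followers⁺ G≥K) o

mutual
  ∈-followers⁻ : ∀ G → K ∈ followers G → Follower G K
  ∈-followers⁻ ⟨ L ∣ R ⟩ (here refl) = self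
  ∈-followers⁻ ⟨ L ∣ R ⟩ (there K∈) with ∈-++⁻ (followersOfAll L) K∈
  ... | inj₁ K∈L = ∈-followersOfAll⁻ L (step {c = blue} self) K∈L
  ... | inj₂ K∈R = ∈-followersOfAll⁻ R (step {c = red} self) K∈R

  ∈-followersOfAll⁻ : ∀ Xs → (∀ {X} → X ∈ Xs → Follower G X) → K ∈ followersOfAll Xs → Follower G K
  ∈-followersOfAll⁻ (Y ∷ Ys) G≥Xs K∈ with ∈-++⁻ (followers Y) K∈
  ... | inj₁ K∈Y  = Follower-trans (G≥Xs (here refl)) (∈-followers⁻ Y K∈Y)
  ... | inj₂ K∈Ys = ∈-followersOfAll⁻ Ys (λ X∈Ys → G≥Xs (there X∈Ys)) K∈Ys

module _ {A : Set} where

  lookupOr : A → List A → ℕ → A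
  lookupOr d []       _       = d
  lookupOr d (x ∷ xs) zero    = x
  lookupOr d (x ∷ xs) (suc i) = lookupOr d xs i

  lookupOr-∈ : ∀ {d xs i} → i <ℕ length xs → lookupOr d xs i ∈ xs
  lookupOr-∈ {xs = x ∷ xs} {zero}  _         = here refl
  lookupOr-∈ {xs = x ∷ xs} {suc i} (s≤s i<n) = there (lookupOr-∈ i<n)

  ∈⇒lookupOr : ∀ {d x xs} → x ∈ xs → ∃[ i ] i <ℕ length xs × lookupOr d xs i ≡ x
  ∈⇒lookupOr (here refl) = zero , s≤s z≤n , refl
  ∈⇒lookupOr (there x∈xs) with i , i<n , eq ← ∈⇒lookupOr x∈xs = suc i , s≤s i<n , eq

  lookupOr-injective : ∀ {R : A → A → Set} {d xs i j} → (∀ {x y} → R x y → R y x) →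
                       AllPairs (λ x y → ¬ R x y) xs → i <ℕ length xs → j <ℕ length xs →
                       R (lookupOr d xs i) (lookupOr d xs j) → i ≡ j
  lookupOr-injective {i = zero}  {zero}  R-sym _ _ _ _ = refl
  lookupOr-injective {i = zero}  {suc j} R-sym (x≉xs ∷ _) _ (s≤s j<n) Rxy =
    ⊥-elim (All.lookup x≉xs (lookupOr-∈ j<n) Rxy)
  lookupOr-injective {i = suc i} {zero}  R-sym (x≉xs ∷ _) (s≤s i<n) _ Rxy =
    ⊥-elim (All.lookup x≉xs (lookupOr-∈ i<n) (R-sym Rxy))
  lookupOr-injective {i = suc i} {suc j} R-sym (_ ∷ distinct) (s≤s i<n) (s≤s j<n) Rxy =
    cong suc (lookupOr-injective R-sym distinct i<n j<n Rxy)

edgeBetween : Colour → ℕ × ℕ → Edge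
edgeBetween c (u , v) = edge c u v

edgesBelow : ℕ → List Edge
edgesBelow n = cartesianProductWith edgeBetween (blue ∷ red ∷ []) (cartesianProduct (upTo n) (upTo n))

∈-edgesBelow⁺ : ∀ {n} → u <ℕ n → v <ℕ n → edge c u v ∈ edgesBelow n
∈-edgesBelow⁺ {c = c} u<n v<n =
  ∈-cartesianProductWith⁺ edgeBetween (colour∈ c) (∈-cartesianProduct⁺ (∈-upTo⁺ u<n) (∈-upTo⁺ v<n))
  where
  colour∈ : ∀ c → c ∈ blue ∷ red ∷ []
  colour∈ blue = here refl
  colour∈ red  = there (here refl)

∈-edgesBelow⁻ : ∀ {n e} → e ∈ edgesBelow n → src e <ℕ n × tgt e <ℕ n
∈-edgesBelow⁻ {n} e∈ with _ , _ , _ , uv∈ , refl ← ∈-cartesianProductWith⁻ edgeBetween (blue ∷ red ∷ []) _ e∈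
  = Product.map ∈-upTo⁻ ∈-upTo⁻ (∈-cartesianProduct⁻ (upTo n) (upTo n) uv∈)

option-dec : ∀ c X Y → Dec (∃[ K ] Opt c X K × K ≈G Y)
option-dec blue X Y = map′ find (λ (_ , K∈ , K≈Y) → lose K∈ K≈Y) (any? (λ K → ≈G-dec K Y) (leftOpts X))
option-dec red  X Y = map′ find (λ (_ , K∈ , K≈Y) → lose K∈ K≈Y) (any? (λ K → ≈G-dec K Y) (rightOpts X))

-- Vertex i is labelled by the i-th follower of G up to equality; the list of
-- followers starts with G, so the source is vertex 0.
module Digraph (G : Game) (cG : Canonical G) where

  vertices : List Game
  vertices = deduplicate ≈G-dec (followers G)

  n : ℕ
  n = length vertices

  label : ℕ → Game
  label = lookupOr G vertices

  IsOptionEdge : Edge → Set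
  IsOptionEdge (edge c u v) = ∃[ K ] Opt c (label u) K × K ≈G label v

  isOptionEdge? : ∀ e → Dec (IsOptionEdge e)
  isOptionEdge? (edge c u v) = option-dec c (label u) (label v)

  edges : List Edge
  edges = filter isOptionEdge? (edgesBelow n)

  ∈-edges⁺ : u <ℕ n → v <ℕ n → IsOptionEdge (edge c u v) → edge c u v ∈ edges
  ∈-edges⁺ u<n v<n = ∈-filter⁺ isOptionEdge? {xs = edgesBelow n} (∈-edgesBelow⁺ u<n v<n)

  ∈-edges⁻ : ∀ {e} → e ∈ edges → (src e <ℕ n × tgt e <ℕ n) × IsOptionEdge e
  ∈-edges⁻ e∈ = Product.map₁ ∈-edgesBelow⁻ (∈-filter⁻ isOptionEdge? {xs = edgesBelow n} e∈)

  0<n : 0 <ℕ n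
  0<n = s≤s z≤n

  label-follower : u <ℕ n → Follower G (label u)
  label-follower u<n = ∈-followers⁻ G (∈-deduplicate⁻ ≈G-dec (followers G) (lookupOr-∈ u<n))

  label-injective : u <ℕ n → v <ℕ n → label u ≈G label v → u ≡ v
  label-injective = lookupOr-injective ≈G-sym (deduplicate-! gameDecSetoid (followers G))

  label-surjective : Follower G K → ∃[ u ] u <ℕ n × label u ≈G K
  label-surjective {K} G≥K
    with _ , K'∈ , K≈K' ← find (Any.deduplicate⁺ ≈G-dec {P = K ≈G_}
                                   (λ Y≈X K≈X → ≈G-trans K≈X (≈G-sym Y≈X))
                                   (lose (∈-followers⁺ G≥K) (≈G-refl K)))
    with u , u<n , refl ← ∈⇒lookupOr {d = G} K'∈
    = u , u<n , ≈G-sym K≈K'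

  vertex⇒< : Vertex 0 edges u → u <ℕ n
  vertex⇒< (inj₁ refl)                 = 0<n
  vertex⇒< (inj₂ (_ , e∈ , inj₁ refl)) = proj₁ (proj₁ (∈-edges⁻ e∈))
  vertex⇒< (inj₂ (_ , e∈ , inj₂ refl)) = proj₂ (proj₁ (∈-edges⁻ e∈))

  -- A follower other than G is an option of an earlier follower, so its vertex is
  -- entered by an edge.
  <⇒vertex : u <ℕ n → Vertex 0 edges u
  <⇒vertex u<n = entered u<n (label-follower u<n) (≈G-refl _)
    where
    entered : u <ℕ n → Follower G K → label u ≈G K → Vertex 0 edges u
    entered u<n self lu≈G = inj₁ (label-injective u<n 0<n lu≈G)
    entered {u} u<n (step {c} G≥K₀ o) lu≈K
      with i , i<n , li≈K₀ ← label-surjective G≥K₀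
      with K' , o' , K≈K' ← option-match (Canonical-follower cG G≥K₀) (Canonical-follower cG (label-follower i<n))
                                         (≈G-sym li≈K₀) c o
      = inj₂ (edge c i u , ∈-edges⁺ i<n u<n (K' , o' , ≈G-trans (≈G-sym K≈K') (≈G-sym lu≈K)) , inj₂ refl)

  represents : RepresentsD G 0 edges
  represents =
      label
    , ≈G-refl G
    , (λ _ vu → label-follower (vertex⇒< vu))
    , (λ _ _ vu vv → label-injective (vertex⇒< vu) (vertex⇒< vv))
    , (λ K G≥K → let u , u<n , lu≈K = label-surjective G≥K in u , <⇒vertex u<n , lu≈K)
    , λ c u v vu vv → mk⇔ (proj₂ ∘ ∈-edges⁻) (∈-edges⁺ (vertex⇒< vu) (vertex⇒< vv))

-- Edit sequences

half^-positive : ∀ d → Positive (half^ d)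
half^-positive zero    = _
half^-positive (suc d) = pos*pos⇒pos ½ (half^ d) {{half^-positive d}}

EditStep-cost-positive : EditStep s E E' a → Positive a
EditStep-cost-positive (add _ d _ _ _)    = half^-positive d
EditStep-cost-positive (remove _ d _ _ _) = half^-positive d

Edits-cost-nonNegative : Edits s E E' a → NonNegative a
Edits-cost-nonNegative done = _
Edits-cost-nonNegative (_∷_ {c = a₁} {c' = a₂} st es) =
  nonNeg+nonNeg⇒nonNeg a₁ {{pos⇒nonNeg a₁ {{EditStep-cost-positive st}}}} a₂ {{Edits-cost-nonNegative es}}

Edits-++ : Edits s E E' a → Edits s E' F b → Edits s E F (a + b)
Edits-++ {b = b} done es = subst (Edits _ _ _) (sym (+-identityˡ b)) es
Edits-++ {b = b} (_∷_ {c = a₁} {c' = a₂} st es₁) es₂ =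
  subst (Edits _ _ _) (sym (+-assoc a₁ a₂ b)) (st ∷ Edits-++ es₁ es₂)

Path-mono : E ⊆ F → Path E u v k → Path F u v k
Path-mono E⊆F here         = here
Path-mono E⊆F (there e∈ p) = there (E⊆F e∈) (Path-mono E⊆F p)

OnlyAddsEdgesFrom : ℕ → List Edge → List Edge → Set
OnlyAddsEdgesFrom u E F = ∀ {x} → x ∈ F → x ∈ E ⊎ src x ≡ u

-- A path to u that leaves u on the way can be cut at that point.
Path-cut : OnlyAddsEdgesFrom u E F → Path F v u k → ∃[ m ] m ≤ℕ k × Path E v u m
Path-cut F⊆E+u here = 0 , z≤n , here
Path-cut F⊆E+u (there e∈ p) with Path-cut F⊆E+u p | F⊆E+u e∈
... | m , m≤k , p' | inj₁ e∈E = suc m , s≤s m≤k , there e∈E p'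
... | _            | inj₂ refl = 0 , z≤n , here

Dist-extend : E ⊆ F → OnlyAddsEdgesFrom u E F → Dist s E u d → Dist s F u d
Dist-extend E⊆F F⊆E+u (p , shortest) =
  Path-mono E⊆F p , λ d' q → let m , m≤d' , q' = Path-cut F⊆E+u q in ≤-trans (shortest m q') m≤d'

Dist-restrict : E ⊆ F → OnlyAddsEdgesFrom u E F → Dist s F u d → Dist s E u d
Dist-restrict E⊆F F⊆E+u (p , shortest) with m , m≤d , p' ← Path-cut F⊆E+u p =
  subst (Path _ _ _) (≤-antisym m≤d (shortest m (Path-mono E⊆F p'))) p' ,
  λ d' q → shortest d' (Path-mono E⊆F q)

_≟ᶜ_ : DecidableEquality Colour
blue ≟ᶜ blue = yes refl
red  ≟ᶜ red  = yes refl
blue ≟ᶜ red  = no λ ()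
red  ≟ᶜ blue = no λ ()

_≟ₑ_ : DecidableEquality Edge
edge c u v ≟ₑ edge c' u' v' =
  map′ (λ { (refl , refl , refl) → refl }) (λ { refl → refl , refl , refl })
       (c ≟ᶜ c' ×-dec u ≟ u' ×-dec v ≟ v')

EditStep-reverse : EditStep s E E' a → EditStep s E' E a
EditStep-reverse {E = E} {E' = E'} (add e d e∉E E'≡e+E dist) =
  remove e d (from (E'≡e+E e) (inj₁ refl)) (λ x → mk⇔ (kept x) (restored x))
         (Dist-extend (λ x∈E → from (E'≡e+E _) (inj₂ x∈E)) new-from-src dist)
  where
  kept : ∀ x → x ∈ E → x ∈ E' × x ≢ e
  kept x x∈E = from (E'≡e+E x) (inj₂ x∈E) , λ { refl → e∉E x∈E }
  restored : ∀ x → x ∈ E' × x ≢ e → x ∈ E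
  restored x (x∈E' , x≢e) = [ (λ x≡e → ⊥-elim (x≢e x≡e)) , id ]′ (to (E'≡e+E x) x∈E')
  new-from-src : OnlyAddsEdgesFrom (src e) E E'
  new-from-src x∈E' = Sum.swap (Sum.map₁ (cong src) (to (E'≡e+E _) x∈E'))
EditStep-reverse {E = E} {E' = E'} (remove e d e∈E E'≡E-e dist) =
  add e d (λ e∈E' → proj₂ (to (E'≡E-e e) e∈E') refl) (λ x → mk⇔ (removed-or-kept x) (restored x))
      (Dist-restrict (λ x∈E' → proj₁ (to (E'≡E-e _) x∈E')) old-from-src dist)
  where
  removed-or-kept : ∀ x → x ∈ E → x ≡ e ⊎ x ∈ E'
  removed-or-kept x x∈E with x ≟ₑ e
  ... | yes x≡e = inj₁ x≡e
  ... | no x≢e  = inj₂ (from (E'≡E-e x) (x∈E , x≢e))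
  restored : ∀ x → x ≡ e ⊎ x ∈ E' → x ∈ E
  restored x (inj₁ refl) = e∈E
  restored x (inj₂ x∈E') = proj₁ (to (E'≡E-e x) x∈E')
  old-from-src : OnlyAddsEdgesFrom (src e) E' E
  old-from-src x∈E = Sum.swap (Sum.map₁ (cong src) (removed-or-kept _ x∈E))

Edits-reverse : Edits s E E' a → Edits s E' E a
Edits-reverse done = done
Edits-reverse (_∷_ {c = a₁} {c' = a₂} st es) =
  subst (Edits _ _ _) (trans (cong (a₂ +_) (+-identityʳ a₁)) (+-comm a₂ a₁))
        (Edits-++ (Edits-reverse es) (EditStep-reverse st ∷ done))

Dist-resp : E ∼[ set ] F → Dist s E u d → Dist s F u d
Dist-resp E∼F = Dist-extend (to E∼F) (λ x∈F → inj₁ (from E∼F x∈F))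

EditStep-respˡ : E ∼[ set ] F → EditStep s F F' a → EditStep s E F' a
EditStep-respˡ E∼F (add e d e∉F F'≡e+F dist) =
  add e d (e∉F ∘ to E∼F) (λ x → ⇔.trans (F'≡e+F x) (⇔.refl ⊎-⇔ ⇔.sym E∼F)) (Dist-resp (⇔.sym E∼F) dist)
EditStep-respˡ E∼F (remove e d e∈F F'≡F-e dist) =
  remove e d (from E∼F e∈F) (λ x → ⇔.trans (F'≡F-e x) (⇔.sym E∼F ×-⇔ ⇔.refl)) (Dist-resp (⇔.sym E∼F) dist)

Edits-respˡ : E ∼[ set ] F → Edits s F F' a → ∃[ E' ] Edits s E E' a × E' ∼[ set ] F'
Edits-respˡ E∼F done      = _ , done , E∼F
Edits-respˡ E∼F (st ∷ es) = _ , EditStep-respˡ E∼F st ∷ es , ⇔.refl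

Vertex-mono : E ⊆ F → Vertex s E u → Vertex s F u
Vertex-mono E⊆F (inj₁ u≡s)              = inj₁ u≡s
Vertex-mono E⊆F (inj₂ (e , e∈E , at-e)) = inj₂ (e , E⊆F e∈E , at-e)

RepresentsD-resp : E ∼[ set ] F → RepresentsD H s E → RepresentsD H s F
RepresentsD-resp {E = E} {F = F} {s = s} E∼F (f , fs≈H , f-fol , f-inj , f-surj , f-edge) =
    f , fs≈H
  , (λ u vu → f-fol u (back vu))
  , (λ u v vu vv → f-inj u v (back vu) (back vv))
  , (λ K H≥K → let u , vu , fu≈K = f-surj K H≥K in u , Vertex-mono (to E∼F) vu , fu≈K)
  , λ c u v vu vv → ⇔.trans (⇔.sym E∼F) (f-edge c u v (back vu) (back vv))
  where
  back : Vertex s F u → Vertex s E u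
  back = Vertex-mono (from E∼F)

-- Relabelling digraphs

mapEdge : (ℕ → ℕ) → Edge → Edge
mapEdge f (edge c u v) = edge c (f u) (f v)

module Relabel (π ρ : ℕ → ℕ) (ρ∘π : ∀ x → ρ (π x) ≡ x) where

  relabel : List Edge → List Edge
  relabel = map (mapEdge π)

  mapEdge-ρ∘π : ∀ e → mapEdge ρ (mapEdge π e) ≡ e
  mapEdge-ρ∘π (edge c u v) = cong₂ (edge c) (ρ∘π u) (ρ∘π v)

  mapEdge-π-injective : ∀ {e e'} → mapEdge π e ≡ mapEdge π e' → e ≡ e'
  mapEdge-π-injective {e} {e'} eq = trans (sym (mapEdge-ρ∘π e)) (trans (cong (mapEdge ρ) eq) (mapEdge-ρ∘π e'))

  ∈-relabel⁺ : ∀ {e} → e ∈ E → mapEdge π e ∈ relabel E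
  ∈-relabel⁺ = ∈-map⁺ (mapEdge π)

  ∈-relabel⁻ : ∀ {x} → x ∈ relabel E → mapEdge ρ x ∈ E
  ∈-relabel⁻ x∈ with e , e∈E , refl ← ∈-map⁻ (mapEdge π) x∈ = subst (_∈ _) (sym (mapEdge-ρ∘π e)) e∈E

  Path-relabel⁺ : Path E u v k → Path (relabel E) (π u) (π v) k
  Path-relabel⁺ here         = here
  Path-relabel⁺ (there e∈ p) = there (∈-relabel⁺ e∈) (Path-relabel⁺ p)

  Path-relabel⁻ : Path (relabel E) u v k → Path E (ρ u) (ρ v) k
  Path-relabel⁻ here         = here
  Path-relabel⁻ (there e∈ p) = there (∈-relabel⁻ e∈) (Path-relabel⁻ p)

  Dist-relabel : Dist s E u d → Dist (π s) (relabel E) (π u) d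
  Dist-relabel {s} {E} {u} (p , shortest) =
    Path-relabel⁺ p ,
    λ d' q → shortest d' (subst₂ (λ x y → Path E x y d') (ρ∘π s) (ρ∘π u) (Path-relabel⁻ q))

  EditStep-relabel : EditStep s E E' a → EditStep (π s) (relabel E) (relabel E') a
  EditStep-relabel {E = E} {E' = E'} (add e d e∉E E'≡e+E dist) =
    add (mapEdge π e) d πe∉ (λ x → mk⇔ (added-or-old x) (present x)) (Dist-relabel dist)
    where
    πe∉ : mapEdge π e ∉ relabel E
    πe∉ πe∈ with e' , e'∈E , eq ← ∈-map⁻ (mapEdge π) πe∈ =
      e∉E (subst (_∈ E) (sym (mapEdge-π-injective eq)) e'∈E)
    added-or-old : ∀ x → x ∈ relabel E' → x ≡ mapEdge π e ⊎ x ∈ relabel E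
    added-or-old x x∈ with y , y∈E' , refl ← ∈-map⁻ (mapEdge π) x∈ =
      Sum.map (cong (mapEdge π)) ∈-relabel⁺ (to (E'≡e+E y) y∈E')
    present : ∀ x → x ≡ mapEdge π e ⊎ x ∈ relabel E → x ∈ relabel E'
    present x (inj₁ refl) = ∈-relabel⁺ (from (E'≡e+E e) (inj₁ refl))
    present x (inj₂ x∈) with y , y∈E , refl ← ∈-map⁻ (mapEdge π) x∈ =
      ∈-relabel⁺ (from (E'≡e+E y) (inj₂ y∈E))
  EditStep-relabel {E = E} {E' = E'} (remove e d e∈E E'≡E-e dist) =
    remove (mapEdge π e) d (∈-relabel⁺ e∈E) (λ x → mk⇔ (kept x) (present x)) (Dist-relabel dist)
    where
    kept : ∀ x → x ∈ relabel E' → x ∈ relabel E × x ≢ mapEdge π e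
    kept x x∈ with y , y∈E' , refl ← ∈-map⁻ (mapEdge π) x∈ =
      let y∈E , y≢e = to (E'≡E-e y) y∈E' in ∈-relabel⁺ y∈E , y≢e ∘ mapEdge-π-injective
    present : ∀ x → x ∈ relabel E × x ≢ mapEdge π e → x ∈ relabel E'
    present x (x∈ , x≢πe) with y , y∈E , refl ← ∈-map⁻ (mapEdge π) x∈ =
      ∈-relabel⁺ (from (E'≡E-e y) (y∈E , x≢πe ∘ cong (mapEdge π)))

  Edits-relabel : Edits s E E' a → Edits (π s) (relabel E) (relabel E') a
  Edits-relabel done      = done
  Edits-relabel (st ∷ es) = EditStep-relabel st ∷ Edits-relabel es

  Vertex-relabel⁺ : Vertex s E u → Vertex (π s) (relabel E) (π u)
  Vertex-relabel⁺ (inj₁ refl)                 = inj₁ refl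
  Vertex-relabel⁺ (inj₂ (e , e∈ , inj₁ refl)) = inj₂ (mapEdge π e , ∈-relabel⁺ e∈ , inj₁ refl)
  Vertex-relabel⁺ (inj₂ (e , e∈ , inj₂ refl)) = inj₂ (mapEdge π e , ∈-relabel⁺ e∈ , inj₂ refl)

  Vertex-relabel⁻ : Vertex (π s) (relabel E) u → Vertex s E (ρ u) × u ≡ π (ρ u)
  Vertex-relabel⁻ {s} (inj₁ refl) = inj₁ (ρ∘π s) , cong π (sym (ρ∘π s))
  Vertex-relabel⁻ (inj₂ (x , x∈ , at)) with e , e∈ , refl ← ∈-map⁻ (mapEdge π) x∈ with at
  ... | inj₁ refl = inj₂ (e , e∈ , inj₁ (sym (ρ∘π (src e)))) , cong π (sym (ρ∘π (src e)))
  ... | inj₂ refl = inj₂ (e , e∈ , inj₂ (sym (ρ∘π (tgt e)))) , cong π (sym (ρ∘π (tgt e)))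

  RepresentsD-relabel : RepresentsD H s E → RepresentsD H (π s) (relabel E)
  RepresentsD-relabel {H} {s} {E} (f , fs≈H , f-fol , f-inj , f-surj , f-edge) =
      f ∘ ρ
    , subst (λ x → f x ≈G H) (sym (ρ∘π s)) fs≈H
    , (λ u vu → f-fol (ρ u) (pull vu))
    , (λ u v vu vv fρu≈fρv →
         trans (π∘ρ vu) (trans (cong π (f-inj (ρ u) (ρ v) (pull vu) (pull vv) fρu≈fρv)) (sym (π∘ρ vv))))
    , (λ K H≥K → let u , vu , fu≈K = f-surj K H≥K
                 in π u , Vertex-relabel⁺ vu , subst (λ x → f x ≈G K) (sym (ρ∘π u)) fu≈K)
    , λ c u v vu vv → mk⇔ (to (f-edge c (ρ u) (ρ v) (pull vu) (pull vv)) ∘ ∈-relabel⁻)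
                          (subst₂ (λ x y → edge c x y ∈ relabel E) (sym (π∘ρ vu)) (sym (π∘ρ vv))
                            ∘ ∈-relabel⁺ ∘ from (f-edge c (ρ u) (ρ v) (pull vu) (pull vv)))
    where
    pull : Vertex (π s) (relabel E) u → Vertex s E (ρ u)
    pull = proj₁ ∘ Vertex-relabel⁻
    π∘ρ : Vertex (π s) (relabel E) u → u ≡ π (ρ u)
    π∘ρ = proj₂ ∘ Vertex-relabel⁻

edge-transfer : ∀ {s' u' v'} → Canonical J → (r : RepresentsD J s E) (r' : RepresentsD J s' F) →
                Vertex s E u → Vertex s E v → Vertex s' F u' → Vertex s' F v' →
                Representation.label r u ≈G Representation.label r' u' →
                Representation.label r v ≈G Representation.label r' v' →
                edge c u v ∈ E → edge c u' v' ∈ F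
edge-transfer {c = c} cJ r r' vu vv vu' vv' u≈u' v≈v' e∈ =
  let K , o , K≈v    = to (R.edge⇔option vu vv) e∈
      K' , o' , K≈K' = option-match (Canonical-follower cJ (R.label-follower vu))
                                    (Canonical-follower cJ (R'.label-follower vu')) u≈u' c o
  in from (R'.edge⇔option vu' vv') (K' , o' , ≈G-trans (≈G-sym K≈K') (≈G-trans K≈v v≈v'))
  where
  module R  = Representation r
  module R' = Representation r'

vertex? : ∀ s E u → Dec (Vertex s E u)
vertex? s E u =
  u ≟ s ⊎-dec map′ find (λ (_ , e∈ , at) → lose e∈ at) (any? (λ e → src e ≟ u ⊎-dec tgt e ≟ u) E)

vertexBound : ℕ → List Edge → ℕ
vertexBound s = foldr (λ e b → src e ⊔ tgt e ⊔ b) s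

Vertex⇒≤bound : Vertex s E u → u ≤ℕ vertexBound s E
Vertex⇒≤bound {E = []}    (inj₁ refl) = ≤-refl
Vertex⇒≤bound {E = e ∷ E} (inj₁ refl) = m≤n⇒m≤o⊔n (src e ⊔ tgt e) (Vertex⇒≤bound {E = E} (inj₁ refl))
Vertex⇒≤bound {E = e ∷ E} (inj₂ (_ , here refl , inj₁ refl)) = m≤n⇒m≤n⊔o _ (m≤m⊔n (src e) (tgt e))
Vertex⇒≤bound {E = e ∷ E} (inj₂ (_ , here refl , inj₂ refl)) = m≤n⇒m≤n⊔o _ (m≤n⊔m (src e) (tgt e))
Vertex⇒≤bound {E = e ∷ E} (inj₂ (x , there x∈ , at)) =
  m≤n⇒m≤o⊔n (src e ⊔ tgt e) (Vertex⇒≤bound {E = E} (inj₂ (x , x∈ , at)))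

-- Two digraphs representing the same game differ by a relabelling: π sends each
-- vertex of the second to the vertex of the first with an equal label, and all other
-- numbers injectively above the vertices of the first.
module Matching {J s E s' F} (cJ : Canonical J) (r : RepresentsD J s E) (r' : RepresentsD J s' F) where
  private
    module R  = Representation r
    module R' = Representation r'

  fresh : ℕ
  fresh = suc (vertexBound s E)

  fresh-not-vertex : ∀ x → ¬ Vertex s E (fresh +ℕ x)
  fresh-not-vertex x v = 1+n≰n (≤-trans (m≤m+n fresh x) (Vertex⇒≤bound v))

  π : ℕ → ℕ
  π x with vertex? s' F x
  ... | yes vx = proj₁ (R.label-surjective (R'.label-follower vx))
  ... | no _   = fresh +ℕ x

  ρ : ℕ → ℕ
  ρ y with vertex? s E y
  ... | yes vy = proj₁ (R'.label-surjective (R.label-follower vy))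
  ... | no _   = y ∸ fresh

  π-vertex : ∀ {x} → Vertex s' F x → Vertex s E (π x) × R.label (π x) ≈G R'.label x
  π-vertex {x} vx with vertex? s' F x
  ... | yes vx' = proj₂ (R.label-surjective (R'.label-follower vx'))
  ... | no ¬vx  = ⊥-elim (¬vx vx)

  π-fresh : ∀ {x} → ¬ Vertex s' F x → π x ≡ fresh +ℕ x
  π-fresh {x} ¬vx with vertex? s' F x
  ... | yes vx = ⊥-elim (¬vx vx)
  ... | no _   = refl

  ρ-vertex : ∀ {y} → Vertex s E y → Vertex s' F (ρ y) × R'.label (ρ y) ≈G R.label y
  ρ-vertex {y} vy with vertex? s E y
  ... | yes vy' = proj₂ (R'.label-surjective (R.label-follower vy'))
  ... | no ¬vy  = ⊥-elim (¬vy vy)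

  ρ-fresh : ∀ {y} → ¬ Vertex s E y → ρ y ≡ y ∸ fresh
  ρ-fresh {y} ¬vy with vertex? s E y
  ... | yes vy = ⊥-elim (¬vy vy)
  ... | no _   = refl

  ρ∘π : ∀ x → ρ (π x) ≡ x
  ρ∘π x = by-cases (vertex? s' F x)
    where
    open ≡-Reasoning
    by-cases : Dec (Vertex s' F x) → ρ (π x) ≡ x
    by-cases (yes vx) = let vπx , πx≈x = π-vertex vx ; vρπx , ρπx≈πx = ρ-vertex vπx
                        in R'.label-injective vρπx vx (≈G-trans ρπx≈πx πx≈x)
    by-cases (no ¬vx) = begin
      ρ (π x)             ≡⟨ cong ρ (π-fresh ¬vx) ⟩
      ρ (fresh +ℕ x)      ≡⟨ ρ-fresh (fresh-not-vertex x) ⟩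
      fresh +ℕ x ∸ fresh  ≡⟨ m+n∸m≡n fresh x ⟩
      x                   ∎

  π∘ρ : ∀ {y} → Vertex s E y → π (ρ y) ≡ y
  π∘ρ vy = let vρy , ρy≈y = ρ-vertex vy ; vπρy , πρy≈ρy = π-vertex vρy
           in R.label-injective vπρy vy (≈G-trans πρy≈ρy ρy≈y)

  π-source : π s' ≡ s
  π-source =
    let vπs' , πs'≈s' = π-vertex (inj₁ refl)
    in R.label-injective vπs' (inj₁ refl) (≈G-trans πs'≈s' (≈G-trans R'.label-source (≈G-sym R.label-source)))

  open Relabel π ρ ρ∘π public

  relabel-∼ : E ∼[ set ] relabel F
  relabel-∼ {x} = mk⇔ (forth x) (back x)
    where
    forth : ∀ x → x ∈ E → x ∈ relabel F
    forth (edge c w w') e∈ =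
      subst₂ (λ y y' → edge c y y' ∈ relabel F) (π∘ρ vw) (π∘ρ vw')
        (∈-relabel⁺ (edge-transfer cJ r r' vw vw' (proj₁ (ρ-vertex vw)) (proj₁ (ρ-vertex vw'))
                                   (≈G-sym (proj₂ (ρ-vertex vw))) (≈G-sym (proj₂ (ρ-vertex vw'))) e∈))
      where
      vw  = inj₂ (edge c w w' , e∈ , inj₁ refl)
      vw' = inj₂ (edge c w w' , e∈ , inj₂ refl)
    back : ∀ x → x ∈ relabel F → x ∈ E
    back x x∈ with e , e∈ , refl ← ∈-map⁻ (mapEdge π) x∈ =
      edge-transfer cJ r' r vs vt (proj₁ (π-vertex vs)) (proj₁ (π-vertex vt))
                    (≈G-sym (proj₂ (π-vertex vs))) (≈G-sym (proj₂ (π-vertex vt))) e∈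
      where
      vs = inj₂ (e , e∈ , inj₁ refl)
      vt = inj₂ (e , e∈ , inj₂ refl)

EditSeqCost-refl : Canonical G → EditSeqCost G G 0ℚ
EditSeqCost-refl {G} cG = 0 , edges , edges , represents , done , represents
  where open Digraph G cG

EditSeqCost-nonNegative : EditSeqCost G H a → 0ℚ ≤ a
EditSeqCost-nonNegative {a = a} (_ , _ , _ , _ , es , _) = nonNegative⁻¹ a {{Edits-cost-nonNegative es}}

EditSeqCost-positive : Canonical G → Canonical H → ¬ G ≈G H → EditSeqCost G H a → 0ℚ < a
EditSeqCost-positive cG cH G≉H (_ , _ , _ , rG , done , rH) = ⊥-elim (G≉H (represents-unique cG cH rG rH))
EditSeqCost-positive cG cH G≉H (_ , _ , _ , _ , _∷_ {c = a₁} {c' = a₂} st es , _) =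
  positive⁻¹ (a₁ + a₂) {{pos+nonNeg⇒pos a₁ {{EditStep-cost-positive st}} a₂ {{Edits-cost-nonNegative es}}}}

EditSeqCost-sym : EditSeqCost G H a → EditSeqCost H G a
EditSeqCost-sym (s , E₀ , E₁ , rG , es , rH) = s , E₁ , E₀ , rH , Edits-reverse es , rG

EditSeqCost-trans : Canonical J → EditSeqCost G J a → EditSeqCost J H b → EditSeqCost G H (a + b)
EditSeqCost-trans {H = H} {b = b} cJ (s , E₀ , E₁ , rG , es , rJ) (s' , F₀ , F₁ , rJ' , es' , rH) =
  let E₂ , es″ , E₂∼ = Edits-respˡ relabel-∼ (subst (λ t → Edits t (relabel F₀) (relabel F₁) b) π-source
                                                     (Edits-relabel es'))
  in s , E₀ , E₂ , rG , Edits-++ es es″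
       , RepresentsD-resp (⇔.sym E₂∼)
                          (subst (λ t → RepresentsD H t (relabel F₁)) π-source (RepresentsD-relabel rH))
  where open Matching cJ rJ rJ'

mainTheorem1 :
    (∀ G → Canonical G → IsWD G G 0ℚ)
    × (∀ G H → Canonical G → Canonical H → ¬ (G ≈G H) →
         ∀ c → IsWD G H c → 0ℚ < c)
    × (∀ G H → Canonical G → Canonical H →
         ∀ c → IsWD G H c → IsWD H G c)
    × (∀ G H J → Canonical G → Canonical H → Canonical J →
         ∀ a b c → IsWD G J a → IsWD J H b → IsWD G H c → c ≤ a + b)
mainTheorem1 =
    (λ G cG → EditSeqCost-refl cG , λ _ → EditSeqCost-nonNegative)
  , (λ G H cG cH G≉H c (GH , _) → EditSeqCost-positive cG cH G≉H GH)
  , (λ G H _ _ c (GH , minimal) → EditSeqCost-sym GH , λ c' HG → minimal c' (EditSeqCost-sym HG))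
  , (λ G H J _ _ cJ a b c (GJ , _) (JH , _) (_ , minimal) → minimal (a + b) (EditSeqCost-trans cJ GJ JH))
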